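{- Let $G$ be a graph on $n \geq 3$ vertices with edge density $\varepsilon$, triangle density $\tau$, and clique-number density $\kappa$. If $G$ is $C_4$-free, then $$\tau \;\geq\; \max\left\{\, \varepsilon^{2}-\frac{(1-\varepsilon)(\kappa n+\varepsilon)}{n-2},\;\; 1-\tfrac{3}{2}(1-\varepsilon)\left(1+\frac{\kappa n}{n-2}\right)\right\}.$$
   Context: Graphs are finite and simple. A graph is $C_4$-free if it has no induced subgraph isomorphic to the cycle on four vertices. For a graph $G=(V,E)$ on $n$ vertices: the edge density is $\varepsilon = |E|/\binom{n}{2}$; the triangle density is $\tau = (\text{number of triangles in } G)/\binom{n}{3}$; the clique number $\omega(G)$ is the order of the largest complete subgraph of $G$; the clique-number density is $\kappa=\omega(G)/n$. -}

module Defs where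

open import Data.Fin.Base using (Fin; toℕ)
import Data.Fin.Properties as Fin
open import Data.Fin.Subset using (Subset; inside; outside; _∈_; ∣_∣)
open import Data.Fin.Subset.Properties using (_∈?_)
open import Data.Integer.Base using (+_)
open import Data.List.Base
  using (List; []; _∷_; _++_; map; filter; length; allFin; cartesianProduct)
open import Data.List.Extrema.Nat using (max)
open import Data.Nat.Base
  using (ℕ; zero; suc; _∸_; _≤_; _<_; z≤n; s≤s; z<s; NonZero; >-nonZero)
open import Data.Nat.Combinatorics using (_C_; nCk+nC[k+1]≡[n+1]C[k+1])
open import Data.Nat.DivMod using (_%_)
open import Data.Nat.Properties as ℕ using (≤-trans; m≤m+n; m<n⇒0<n∸m)
open import Data.Product using (_×_; _,_; Σ-syntax)
open import Data.Rational.Base as ℚ using (ℚ; _/_)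
open import Data.Sum.Base using (_⊎_; swap)
open import Data.Vec.Base using ([]; _∷_)
open import Function.Bundles using (_⇔_)
open import Function.Definitions using (Injective)
open import Level using (0ℓ)
open import Relation.Binary.Core using (Rel)
open import Relation.Binary.Definitions using (Decidable; Symmetric)
open import Relation.Binary.PropositionalEquality using (_≡_; _≢_; subst)
open import Relation.Nullary.Decidable
  using (Dec; from-yes; _×-dec_; _⊎-dec_; _→-dec_; ¬?)
open import Relation.Nullary.Negation using (¬_)

-- Finite simple graphs, with vertex set Fin n.
record Graph (n : ℕ) : Set₁ where
  field
    Adj    : Rel (Fin n) 0ℓ
    adj?   : Decidable Adj
    sym    : Symmetric Adj
    irrefl : ∀ i → ¬ Adj i i

open Graph public using (Adj; adj?)

InducedSubgraph : ∀ {m n} → Graph m → Graph n → Set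
InducedSubgraph {m} {n} H G =
  Σ[ f ∈ (Fin m → Fin n) ]
    Injective _≡_ _≡_ f × (∀ i j → Adj H i j ⇔ Adj G (f i) (f j))

C₄ : Graph 4
C₄ = record
  { Adj    = λ i j → Next i j ⊎ Next j i
  ; adj?   = next⊎?
  ; sym    = swap
  ; irrefl = from-yes (Fin.all? λ i → ¬? (next⊎? i i))
  }
  where
  Next : Rel (Fin 4) 0ℓ
  Next i j = suc (toℕ i) % 4 ≡ toℕ j

  next⊎? : Decidable (λ i j → Next i j ⊎ Next j i)
  next⊎? i j = (_ ℕ.≟ _) ⊎-dec (_ ℕ.≟ _)

C₄-Free : ∀ {n} → Graph n → Set
C₄-Free G = ¬ InducedSubgraph C₄ G

-- Each edge and each triangle is listed once, with its vertices in
-- increasing order.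
edges : ∀ {n} → Graph n → List (Fin n × Fin n)
edges {n} G =
  filter (λ (i , j) → (i Fin.<? j) ×-dec adj? G i j)
         (cartesianProduct (allFin n) (allFin n))

triangles : ∀ {n} → Graph n → List (Fin n × Fin n × Fin n)
triangles {n} G =
  filter (λ (i , j , k) → (i Fin.<? j) ×-dec (j Fin.<? k) ×-dec
                          adj? G i j ×-dec adj? G j k ×-dec adj? G i k)
         (cartesianProduct (allFin n) (cartesianProduct (allFin n) (allFin n)))

IsClique : ∀ {n} → Graph n → Subset n → Set
IsClique G S = ∀ i j → i ∈ S → j ∈ S → i ≢ j → Adj G i j

isClique? : ∀ {n} (G : Graph n) (S : Subset n) → Dec (IsClique G S)
isClique? G S = Fin.all? λ i → Fin.all? λ j →
  (i ∈? S) →-dec ((j ∈? S) →-dec (¬? (i Fin.≟ j) →-dec adj? G i j))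

allSubsets : ∀ n → List (Subset n)
allSubsets zero    = [] ∷ []
allSubsets (suc n) =
  map (outside ∷_) (allSubsets n) ++ map (inside ∷_) (allSubsets n)

-- The base value 0 is harmless: the empty set is always a clique.
cliqueNumber : ∀ {n} → Graph n → ℕ
cliqueNumber {n} G = max 0 (map ∣_∣ (filter (isClique? G) (allSubsets n)))

0<nCk : ∀ n k → k ≤ n → 0 < n C k
0<nCk n       zero    _         = z<s
0<nCk (suc n) (suc k) (s≤s k≤n) =
  subst (0 <_) (nCk+nC[k+1]≡[n+1]C[k+1] n k)
    (≤-trans (0<nCk n k k≤n) (m≤m+n (n C k) (n C suc k)))

nCk-nonZero : ∀ {n k} → k ≤ n → NonZero (n C k)
nCk-nonZero {n} {k} k≤n = >-nonZero (0<nCk n k k≤n)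

n∸2-nonZero : ∀ {n} → 3 ≤ n → NonZero (n ∸ 2)
n∸2-nonZero 2<n = >-nonZero (m<n⇒0<n∸m 2<n)

edgeDensity : ∀ {n} → Graph n → 2 ≤ n → ℚ
edgeDensity {n} G 2≤n = (+ length (edges G) / (n C 2)) {{nCk-nonZero 2≤n}}

triangleDensity : ∀ {n} → Graph n → 3 ≤ n → ℚ
triangleDensity {n} G 3≤n =
  (+ length (triangles G) / (n C 3)) {{nCk-nonZero 3≤n}}

cliqueNumberDensity : ∀ {n} → Graph n → 1 ≤ n → ℚ
cliqueNumberDensity {n} G 1≤n = (+ cliqueNumber G / n) {{>-nonZero 1≤n}}

fromℕ : ℕ → ℚ
fromℕ n = + n / 1

infixl 7 _/ℕ_

_/ℕ_ : ℚ → (d : ℕ) → .{{NonZero d}} → ℚ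
p /ℕ d = p ℚ.* (+ 1 / d)

{-# OPTIONS --safe #-}

-- Let ω be the clique number, E and F the numbers of ordered adjacent and
-- ordered distinct nonadjacent pairs, and S the number of ordered triangles.
-- In a C₄-free graph the common neighbours of two nonadjacent vertices form a
-- clique, so the number Q of ordered pairs of distinct nonadjacent vertices
-- with a marked common neighbour is at most F ω.  Since Σ deg² = S + Q + E,
-- Cauchy-Schwarz gives E² ≤ n (S + F ω + E), which is the first bound.
-- For the second, sort the vertex triples by the number of edges they span.
-- Counting the pairs (edge, third vertex) and (nonedge, third vertex) and
-- discarding the triples without edges gives
-- 2nE + 2F ≤ 2S + 3Q + 4E + nF, and again Q ≤ F ω.
module Submission where

open import Data.Nat.Base using (ℕ; zero; suc)
open import Relation.Binary.PropositionalEquality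
open import Defs

module Counting where
  open import Data.Bool.Base using (Bool; true; false; _∧_; _∨_; not; if_then_else_)
  open import Data.Empty using (⊥-elim)
  open import Data.Fin.Base using (Fin; zero; suc)
  open import Data.Fin.Patterns using (0F; 1F; 2F; 3F)
  import Data.Fin.Properties as Fin
  open import Data.Fin.Subset using (Subset; _∈_; ∣_∣; inside; outside)
  open import Data.List.Base as List using (length; filter; allFin; cartesianProduct; []; _∷_)
  open import Data.List.Extrema.Nat using (xs≤max)
  import Data.List.Membership.Propositional as List
  open import Data.List.Membership.Propositional.Properties
    using (∈-filter⁺; ∈-map⁺; ∈-++⁺ˡ; ∈-++⁺ʳ)
  open import Data.List.Properties using (length-++; filter-++)
  import Data.List.Relation.Unary.All as All
  open import Data.List.Relation.Unary.Any using (here)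
  open import Data.Nat.Base using (_+_; _*_; _≤_; z≤n)
  open import Data.Nat.Properties
  open import Data.Nat.Solver using (module +-*-Solver)
  open import Data.Product using (_×_; _,_)
  open import Data.Sum.Base using (inj₁; inj₂)
  open import Data.Vec.Base as Vec using ([]; _∷_)
  open import Data.Vec.Properties using (lookup∘tabulate; []=⇒lookup)
  open import Function.Base using (_∘_; id)
  open import Function.Bundles using (mk⇔; _⇔_)
  open import Function.Definitions using (Injective)
  open import Relation.Nullary.Decidable
    using (Dec; does; yes; no; _×-dec_; dec-true; dec-false; decidable-stable)
  open import Relation.Nullary.Negation using (¬_; contradiction)
  open import Relation.Unary using (Decidable)
  open import Algebra.Properties.Semiring.Sum +-*-semiring
    using (sum; sum-syntax; sum-cong-≗; ∑-comm; ∑-distrib-+; sum-replicate-zero;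
           *-distribˡ-sum; *-distribʳ-sum)

  -- Finite sums over `Fin n`, counting by indicator sums, and symmetric summands.

  Matrix : ℕ → Set
  Matrix n = Fin n → Fin n → ℕ

  χ : Bool → ℕ
  χ b = if b then 1 else 0

  infix 4 _<ᶠ_

  _<ᶠ_ : ∀ {n} → Fin n → Fin n → Bool
  i <ᶠ j = does (i Fin.<? j)

  ∑-zero : ∀ {n} {f : Fin n → ℕ} → (∀ i → f i ≡ 0) → sum f ≡ 0
  ∑-zero {n} f≡0 = trans (sum-cong-≗ f≡0) (sum-replicate-zero n)

  ∑-mono : ∀ {n} {f g : Fin n → ℕ} → (∀ i → f i ≤ g i) → sum f ≤ sum g
  ∑-mono {zero}  f≤g = z≤n
  ∑-mono {suc n} f≤g = +-mono-≤ (f≤g zero) (∑-mono (f≤g ∘ suc))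

  ∑-const : ∀ n c → ∑[ i < n ] c ≡ n * c
  ∑-const zero    c = refl
  ∑-const (suc n) c = cong (c +_) (∑-const n c)

  length-filter-map : ∀ {A B : Set} {P : B → Set} (P? : Decidable P) (f : A → B) xs →
    length (filter P? (List.map f xs)) ≡ length (filter (P? ∘ f) xs)
  length-filter-map P? f []       = refl
  length-filter-map P? f (x ∷ xs) with does (P? (f x))
  ... | true  = cong suc (length-filter-map P? f xs)
  ... | false = length-filter-map P? f xs

  length-filter-tabulate : ∀ {n} {A : Set} {P : A → Set} (P? : Decidable P) (f : Fin n → A) →
    length (filter P? (List.tabulate f)) ≡ ∑[ i < n ] χ (does (P? (f i)))
  length-filter-tabulate {zero}  P? f = refl
  length-filter-tabulate {suc n} P? f with does (P? (f zero))
  ... | true  = cong suc (length-filter-tabulate P? (f ∘ suc))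
  ... | false = length-filter-tabulate P? (f ∘ suc)

  length-filter-cartesianProduct : ∀ {n} {A B : Set} {P : A × B → Set} (P? : Decidable P)
    (f : Fin n → A) ys →
    length (filter P? (cartesianProduct (List.tabulate f) ys)) ≡
    ∑[ i < n ] length (filter (λ y → P? (f i , y)) ys)
  length-filter-cartesianProduct {zero}  P? f ys = refl
  length-filter-cartesianProduct {suc n} P? f ys = begin
    length (filter P? (row List.++ rest))
      ≡⟨ cong length (filter-++ P? row rest) ⟩
    length (filter P? row List.++ filter P? rest)
      ≡⟨ length-++ (filter P? row) ⟩
    length (filter P? row) + length (filter P? rest)
      ≡⟨ cong₂ _+_ (length-filter-map P? (f zero ,_) ys)
                   (length-filter-cartesianProduct P? (f ∘ suc) ys) ⟩
    ∑[ i < suc n ] length (filter (λ y → P? (f i , y)) ys) ∎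
    where
    open ≡-Reasoning
    row  = List.map (f zero ,_) ys
    rest = cartesianProduct (List.tabulate (f ∘ suc)) ys

  -- The pairs (i, j) and (j, i) contribute equally and the diagonal nothing. The induction strips
  -- the first row and column, whose sums agree by symmetry; comparisons with `zero` compute, so its
  -- last line is already the right-hand side.
  ∑-symmetric : ∀ {n} (F : Matrix n) → (∀ i j → F i j ≡ F j i) → (∀ i → F i i ≡ 0) →
    ∑[ i < n ] ∑[ j < n ] F i j ≡
    2 * ∑[ i < n ] ∑[ j < n ] (if i <ᶠ j then F i j else 0)
  ∑-symmetric {zero}  F swap diag = refl
  ∑-symmetric {suc n} F swap diag = begin
    F zero zero + p + ∑[ i < n ] (F (suc i) zero + ∑[ j < n ] F (suc i) (suc j))
      ≡⟨ cong₂ (λ x y → x + p + y) (diag zero) (∑-distrib-+ (λ i → F (suc i) zero) _) ⟩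
    p + (∑[ i < n ] F (suc i) zero + ∑[ i < n ] ∑[ j < n ] F (suc i) (suc j))
      ≡⟨ cong₂ (λ x y → p + (x + y)) (sum-cong-≗ λ i → swap (suc i) zero)
           (∑-symmetric (λ i j → F (suc i) (suc j)) (λ i j → swap (suc i) (suc j)) (diag ∘ suc)) ⟩
    p + (p + 2 * r)
      ≡⟨ solve 2 (λ p r → p :+ (p :+ con 2 :* r) := con 2 :* (p :+ r)) refl p r ⟩
    2 * (p + r) ∎
    where
    open ≡-Reasoning
    open +-*-Solver
    p = ∑[ j < n ] F zero (suc j)
    r = ∑[ i < n ] ∑[ j < n ] (if i <ᶠ j then F (suc i) (suc j) else 0)

  -- The two transpositions generate all six reorderings of a triple, so `F` vanishes as soon as any
  -- two entries agree. Testing `j <ᶠ k` on the outside makes every term with `k = zero` compute to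
  -- 0; with the tests exchanged, `if suc i <ᶠ suc j then 0 else 0` would be stuck.
  ∑-symmetric₃ : ∀ {n} (F : Fin n → Fin n → Fin n → ℕ) →
    (∀ i j k → F i j k ≡ F j i k) → (∀ i j k → F i j k ≡ F i k j) →
    (∀ i k → F i i k ≡ 0) →
    ∑[ i < n ] ∑[ j < n ] ∑[ k < n ] F i j k ≡
    6 * ∑[ i < n ] ∑[ j < n ] ∑[ k < n ]
      (if j <ᶠ k then (if i <ᶠ j then F i j k else 0) else 0)
  ∑-symmetric₃ {zero}  F swap₁₂ swap₂₃ diag = refl
  ∑-symmetric₃ {suc n} F swap₁₂ swap₂₃ diag = begin
    ∑[ j < suc n ] ∑[ k < suc n ] F zero j k +
    ∑[ i < n ] ∑[ j < suc n ] ∑[ k < suc n ] F (suc i) j k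
      -- The three copies of `P` are the triples with `zero` in the first, second and third
      -- position; `R` collects those avoiding `zero`.
      ≡⟨ cong₂ _+_ first others ⟩
    P + (P + P + R)
      ≡⟨ cong₂ (λ x y → x + (x + x + y))
           (∑-symmetric (λ j k → F zero (suc j) (suc k)) (λ j k → swap₂₃ zero (suc j) (suc k))
             (λ j → diag₂₃ zero (suc j)))
           (∑-symmetric₃ (λ i j k → F (suc i) (suc j) (suc k))
             (λ i j k → swap₁₂ (suc i) (suc j) (suc k)) (λ i j k → swap₂₃ (suc i) (suc j) (suc k))
             (λ i k → diag (suc i) (suc k))) ⟩
    2 * p + (2 * p + 2 * p + 6 * r)
      ≡⟨ solve 2 (λ p r → con 2 :* p :+ (con 2 :* p :+ con 2 :* p :+ con 6 :* r) :=
                          con 6 :* (p :+ r)) refl p r ⟩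
    6 * (p + r)
      -- With `j = zero` the restricted summand is 0 for each `k`, but its sum over `k` does not
      -- reduce to 0, so these rows need `∑-zero`.
      ≡⟨ cong (6 *_) (cong₂ _+_
           (cong (_+ p) (∑-zero {n} λ _ → refl))
           (sum-cong-≗ λ i → cong (_+ ∑[ j < n ] ∑[ k < n ]
              (if j <ᶠ k then (if i <ᶠ j then F (suc i) (suc j) (suc k) else 0) else 0))
              (∑-zero {n} λ _ → refl))) ⟨
    6 * ∑[ i < suc n ] ∑[ j < suc n ] ∑[ k < suc n ]
      (if j <ᶠ k then (if i <ᶠ j then F i j k else 0) else 0) ∎
    where
    open ≡-Reasoning
    open +-*-Solver
    P = ∑[ j < n ] ∑[ k < n ] F zero (suc j) (suc k)
    R = ∑[ i < n ] ∑[ j < n ] ∑[ k < n ] F (suc i) (suc j) (suc k)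
    p = ∑[ j < n ] ∑[ k < n ] (if j <ᶠ k then F zero (suc j) (suc k) else 0)
    r = ∑[ i < n ] ∑[ j < n ] ∑[ k < n ]
          (if j <ᶠ k then (if i <ᶠ j then F (suc i) (suc j) (suc k) else 0) else 0)

    diag₂₃ : ∀ i j → F i j j ≡ 0
    diag₂₃ i j = trans (swap₁₂ i j j) (trans (swap₂₃ j i j) (diag j i))

    diag₁₃ : ∀ i j → F i j i ≡ 0
    diag₁₃ i j = trans (swap₂₃ i j i) (diag i j)

    first : ∑[ j < suc n ] ∑[ k < suc n ] F zero j k ≡ P
    first = cong₂ _+_ (∑-zero (diag zero))
      (sum-cong-≗ λ j → cong (_+ ∑[ k < n ] F zero (suc j) (suc k)) (diag₁₃ zero (suc j)))

    slice : ∀ i → ∑[ j < suc n ] ∑[ k < suc n ] F (suc i) j k ≡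
      ∑[ k < n ] F zero (suc i) (suc k) + ∑[ k < n ] F zero (suc i) (suc k) +
      ∑[ j < n ] ∑[ k < n ] F (suc i) (suc j) (suc k)
    slice i = begin
      F (suc i) zero zero + ∑[ k < n ] F (suc i) zero (suc k) +
      ∑[ j < n ] (F (suc i) (suc j) zero + ∑[ k < n ] F (suc i) (suc j) (suc k))
        ≡⟨ cong₂ _+_
             (cong₂ _+_ (diag₂₃ (suc i) zero) (sum-cong-≗ λ k → swap₁₂ (suc i) zero (suc k)))
             (trans (∑-distrib-+ (λ j → F (suc i) (suc j) zero) _)
               (cong (_+ ∑[ j < n ] ∑[ k < n ] F (suc i) (suc j) (suc k))
                 (sum-cong-≗ λ j → trans (swap₂₃ (suc i) (suc j) zero)
                                         (swap₁₂ (suc i) zero (suc j))))) ⟩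
      q + (q + s)
        ≡⟨ +-assoc q q s ⟨
      q + q + s ∎
      where
      q = ∑[ k < n ] F zero (suc i) (suc k)
      s = ∑[ j < n ] ∑[ k < n ] F (suc i) (suc j) (suc k)

    others : ∑[ i < n ] ∑[ j < suc n ] ∑[ k < suc n ] F (suc i) j k ≡ P + P + R
    others = trans (sum-cong-≗ slice)
      (trans (∑-distrib-+ (λ i → q i + q i) _) (cong (_+ R) (∑-distrib-+ q q)))
      where
      q : Fin n → ℕ
      q i = ∑[ k < n ] F zero (suc i) (suc k)

  -- The Cauchy-Schwarz inequality in the natural numbers.

  2ab≤a²+b² : ∀ a b → 2 * (a * b) ≤ a * a + b * b
  2ab≤a²+b² a b with ≤-total a b
  -- Writing the larger number as the smaller plus `c` avoids subtraction; the two sides then differ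
  -- by `c * c`.
  ... | inj₁ a≤b with c , refl ← m≤n⇒∃[o]m+o≡n a≤b =
    subst (2 * (a * (a + c)) ≤_)
      (solve 2 (λ a c → con 2 :* (a :* (a :+ c)) :+ c :* c := a :* a :+ (a :+ c) :* (a :+ c))
        refl a c)
      (m≤m+n _ (c * c))
    where open +-*-Solver
  ... | inj₂ b≤a with c , refl ← m≤n⇒∃[o]m+o≡n b≤a =
    subst (2 * ((b + c) * b) ≤_)
      (solve 2 (λ b c → con 2 :* ((b :+ c) :* b) :+ c :* c := (b :+ c) :* (b :+ c) :+ b :* b)
        refl b c)
      (m≤m+n _ (c * c))
    where open +-*-Solver

  -- Bounds the cross term that arises in `cauchy-schwarz` when the first value `a` is split off; it
  -- is `2ab≤a²+b²` summed over `f`.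
  2a∑≤na²+∑² : ∀ {n} a (f : Fin n → ℕ) →
    2 * (a * sum f) ≤ n * (a * a) + ∑[ i < n ] (f i * f i)
  2a∑≤na²+∑² {n} a f = begin
    2 * (a * sum f)
      ≡⟨ trans (cong (2 *_) (*-distribˡ-sum a f)) (*-distribˡ-sum 2 (λ i → a * f i)) ⟩
    ∑[ i < n ] (2 * (a * f i))
      ≤⟨ ∑-mono (λ i → 2ab≤a²+b² a (f i)) ⟩
    ∑[ i < n ] (a * a + f i * f i)
      ≡⟨ ∑-distrib-+ (λ _ → a * a) (λ i → f i * f i) ⟩
    ∑[ i < n ] (a * a) + ∑[ i < n ] (f i * f i)
      ≡⟨ cong (_+ ∑[ i < n ] (f i * f i)) (∑-const n (a * a)) ⟩
    n * (a * a) + ∑[ i < n ] (f i * f i) ∎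
    where open ≤-Reasoning

  cauchy-schwarz : ∀ {n} (f : Fin n → ℕ) → sum f * sum f ≤ n * ∑[ i < n ] (f i * f i)
  cauchy-schwarz {zero}  f = z≤n
  cauchy-schwarz {suc n} f = begin
    (a + s) * (a + s)
      ≡⟨ solve 2 (λ a s → (a :+ s) :* (a :+ s) := a :* a :+ con 2 :* (a :* s) :+ s :* s)
           refl a s ⟩
    a * a + 2 * (a * s) + s * s
      ≤⟨ +-mono-≤ (+-monoʳ-≤ (a * a) (2a∑≤na²+∑² a (f ∘ suc))) (cauchy-schwarz (f ∘ suc)) ⟩
    a * a + (n * (a * a) + q) + n * q
      ≡⟨ solve 3 (λ a n q → a :* a :+ (n :* (a :* a) :+ q) :+ n :* q :=
                            (con 1 :+ n) :* (a :* a :+ q)) refl a n q ⟩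
    suc n * (a * a + q) ∎
    where
    open ≤-Reasoning
    open +-*-Solver
    a = f zero
    s = sum (f ∘ suc)
    q = ∑[ i < n ] (f (suc i) * f (suc i))

  -- Matrices over ℕ and weighted counts of vertex triples.

  δ : ∀ {n} → Matrix n
  δ i j = χ (does (i Fin.≟ j))

  ∑-δ : ∀ {n} (f : Fin n → ℕ) i → ∑[ k < n ] (f k * δ i k) ≡ f i
  ∑-δ {suc n} f zero = begin
    f zero * 1 + ∑[ k < n ] (f (suc k) * 0)
      ≡⟨ cong₂ _+_ (*-identityʳ (f zero)) (∑-zero λ k → *-zeroʳ (f (suc k))) ⟩
    f zero + 0
      ≡⟨ +-identityʳ (f zero) ⟩
    f zero ∎
    where open ≡-Reasoning
  ∑-δ {suc n} f (suc i) =
    cong₂ _+_ (*-zeroʳ (f zero)) (∑-δ (f ∘ suc) i)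

  Sym : ∀ {n} → Matrix n → Set
  Sym X = ∀ i j → X i j ≡ X j i

  total : ∀ {n} → Matrix n → ℕ
  total {n} X = ∑[ i < n ] ∑[ j < n ] X i j

  total-cong : ∀ {n} {X Y : Matrix n} → (∀ i j → X i j ≡ Y i j) → total X ≡ total Y
  total-cong X≡Y = sum-cong-≗ λ i → sum-cong-≗ (X≡Y i)

  total-+ : ∀ {n} (X Y : Matrix n) → total (λ i j → X i j + Y i j) ≡ total X + total Y
  total-+ {n} X Y = trans (sum-cong-≗ λ i → ∑-distrib-+ (X i) (Y i))
    (∑-distrib-+ (λ i → sum (X i)) (λ i → sum (Y i)))

  total-*ˡ : ∀ {n} c (X : Matrix n) → c * total X ≡ total (λ i j → c * X i j)
  total-*ˡ {n} c X = trans (*-distribˡ-sum c (λ i → sum (X i)))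
    (sum-cong-≗ λ i → *-distribˡ-sum c (X i))

  total-*ʳ : ∀ {n} (X : Matrix n) c → total X * c ≡ total (λ i j → X i j * c)
  total-*ʳ {n} X c = trans (*-distribʳ-sum c (λ i → sum (X i)))
    (sum-cong-≗ λ i → *-distribʳ-sum c (X i))

  𝟙 : ∀ {n} → Matrix n
  𝟙 _ _ = 1

  -- A triple (i, j, k) is weighed on its pairs ij, jk and ik. With 0/1 matrices this counts the
  -- triples in which each pair has a prescribed relation; `𝟙` leaves a pair free and `δ` identifies
  -- its ends.
  T : ∀ {n} → Matrix n → Matrix n → Matrix n → ℕ
  T {n} X Y Z = ∑[ i < n ] ∑[ j < n ] ∑[ k < n ] (X i j * Y j k * Z i k)

  -- Interchanging i and j keeps the pair ij and exchanges jk with ik. The kept pair is read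
  -- backwards, which is where symmetry enters; `T-swap₁₃` does the same with j and k.
  T-swap₂₃ : ∀ {n} {X : Matrix n} Y Z → Sym X → T X Y Z ≡ T X Z Y
  T-swap₂₃ {n} {X} Y Z symX = trans (∑-comm (λ i j → ∑[ k < n ] (X i j * Y j k * Z i k)))
    (total-cong λ i j → sum-cong-≗ λ k →
      trans (cong (λ x → x * Y i k * Z j k) (symX j i)) (*-swapʳ (X i j) (Y i k) (Z j k)))
    where
    open +-*-Solver
    *-swapʳ : ∀ x y z → x * y * z ≡ x * z * y
    *-swapʳ = solve 3 (λ x y z → x :* y :* z := x :* z :* y) refl

  T-swap₁₃ : ∀ {n} X {Y : Matrix n} Z → Sym Y → T X Y Z ≡ T Z Y X
  T-swap₁₃ {n} X {Y} Z symY = sum-cong-≗ λ i →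
    trans (∑-comm (λ j k → X i j * Y j k * Z i k))
      (sum-cong-≗ λ j → sum-cong-≗ λ k →
        trans (cong (λ y → X i k * y * Z i j) (symY k j)) (*-rev (X i k) (Y j k) (Z i j)))
    where
    open +-*-Solver
    *-rev : ∀ x y z → x * y * z ≡ z * y * x
    *-rev = solve 3 (λ x y z → x :* y :* z := z :* y :* x) refl

  T-𝟙𝟙 : ∀ {n} (X : Matrix n) → T X 𝟙 𝟙 ≡ n * total X
  T-𝟙𝟙 {n} X = trans
    (total-cong λ i j → trans (∑-const n (X i j * 1 * 1))
      (cong (n *_) (trans (*-identityʳ (X i j * 1)) (*-identityʳ (X i j)))))
    (sym (total-*ˡ n X))

  -- `δ` forces k = i, so the pair jk becomes ij read backwards.
  T-δ : ∀ {n} X {Y : Matrix n} → Sym Y → T X Y δ ≡ total (λ i j → X i j * Y i j)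
  T-δ {n} X {Y} symY = total-cong λ i j →
    trans (∑-δ (λ k → X i j * Y j k) i) (cong (X i j *_) (symY j i))

  T-+ʳ : ∀ {n} (X Y Z W : Matrix n) → T X Y (λ i j → Z i j + W i j) ≡ T X Y Z + T X Y W
  T-+ʳ X Y Z W = trans
    (total-cong λ i j → trans
      (sum-cong-≗ λ k → *-distribˡ-+ (X i j * Y j k) (Z i k) (W i k))
      (∑-distrib-+ (λ k → X i j * Y j k * Z i k) (λ k → X i j * Y j k * W i k)))
    (total-+ (λ i j → sum λ k → X i j * Y j k * Z i k) (λ i j → sum λ k → X i j * Y j k * W i k))

  T-congʳ : ∀ {n} (X Y : Matrix n) {Z W : Matrix n} → (∀ i j → Z i j ≡ W i j) → T X Y Z ≡ T X Y W
  T-congʳ X Y Z≡W = total-cong λ i j → sum-cong-≗ λ k → cong (X i j * Y j k *_) (Z≡W i k)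

  -- Subsets given by Boolean predicates, and their sizes.

  does-true⇒ : ∀ {A : Set} (a? : Dec A) → does a? ≡ true → A
  does-true⇒ (yes a) _ = a

  ∣tabulate∣ : ∀ {n} (f : Fin n → Bool) → ∣ Vec.tabulate f ∣ ≡ ∑[ i < n ] χ (f i)
  ∣tabulate∣ {zero}  f = refl
  ∣tabulate∣ {suc n} f with f zero
  ... | true  = cong suc (∣tabulate∣ (f ∘ suc))
  ... | false = ∣tabulate∣ (f ∘ suc)

  ∈-allSubsets : ∀ {n} (S : Subset n) → S List.∈ allSubsets n
  ∈-allSubsets []            = here refl
  ∈-allSubsets (outside ∷ S) = ∈-++⁺ˡ (∈-map⁺ (outside ∷_) (∈-allSubsets S))
  ∈-allSubsets (inside ∷ S)  = ∈-++⁺ʳ (List.map (outside ∷_) (allSubsets _))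
    (∈-map⁺ (inside ∷_) (∈-allSubsets S))

  χ-∧ : ∀ a b → χ (a ∧ b) ≡ χ a * χ b
  χ-∧ true  b = sym (+-identityʳ (χ b))
  χ-∧ false b = refl

  -- Adjacency matrices, and the edge and triangle counts as sums over them.

  module _ {n : ℕ} (G : Graph n) where

    clique⇒∣S∣≤cliqueNumber : ∀ {S} → IsClique G S → ∣ S ∣ ≤ cliqueNumber G
    clique⇒∣S∣≤cliqueNumber {S} clique = All.lookup
      (xs≤max 0 (List.map ∣_∣ (filter (isClique? G) (allSubsets n))))
      (∈-map⁺ ∣_∣ (∈-filter⁺ (isClique? G) (∈-allSubsets S) clique))

    adjacent? : Fin n → Fin n → Bool
    adjacent? i j = does (adj? G i j)

    -- Adjacency matrices of the graph and of its complement. `B` is zero on the diagonal, so `A`,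
    -- `B` and `δ` partition all ordered pairs.
    A B : Matrix n
    A i j = χ (adjacent? i j)
    B i j = χ (not (adjacent? i j ∨ does (i Fin.≟ j)))

    Adj⇒≢ : ∀ {i j} → Adj G i j → i ≢ j
    Adj⇒≢ a refl = Graph.irrefl G _ a

    adjacent?-sym : ∀ i j → adjacent? i j ≡ adjacent? j i
    adjacent?-sym i j with adj? G i j
    ... | yes a = sym (dec-true (adj? G j i) (Graph.sym G a))
    ... | no ¬a = sym (dec-false (adj? G j i) (¬a ∘ Graph.sym G))

    A-sym : Sym A
    A-sym i j = cong χ (adjacent?-sym i j)

    ≟-sym : ∀ (i j : Fin n) → does (i Fin.≟ j) ≡ does (j Fin.≟ i)
    ≟-sym i j with i Fin.≟ j
    ... | yes i≡j = sym (dec-true (j Fin.≟ i) (sym i≡j))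
    ... | no  i≢j = sym (dec-false (j Fin.≟ i) (i≢j ∘ sym))

    B-sym : Sym B
    B-sym i j = cong₂ (λ a b → χ (not (a ∨ b))) (adjacent?-sym i j) (≟-sym i j)

    A-diag : ∀ i → A i i ≡ 0
    A-diag i = cong χ (dec-false (adj? G i i) (Graph.irrefl G i))

    A+B+δ≡𝟙 : ∀ i j → A i j + B i j + δ i j ≡ 1
    A+B+δ≡𝟙 i j with adj? G i j | i Fin.≟ j
    ... | yes a | yes i≡j = contradiction i≡j (Adj⇒≢ a)
    ... | yes _ | no _    = refl
    ... | no _  | yes _   = refl
    ... | no _  | no _    = refl

    AA≡A : ∀ i j → A i j * A i j ≡ A i j
    AA≡A i j with adjacent? i j
    ... | true  = refl
    ... | false = refl

    AB≡0 : ∀ i j → A i j * B i j ≡ 0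
    AB≡0 i j with adjacent? i j
    ... | true  = refl
    ... | false = refl

    BB≡B : ∀ i j → B i j * B i j ≡ B i j
    BB≡B i j with not (adjacent? i j ∨ does (i Fin.≟ j))
    ... | true  = refl
    ... | false = refl

    -- An edge is listed once, with increasing ends, but fills two symmetric entries of `A`.
    total-A : total A ≡ 2 * length (edges G)
    total-A = trans (∑-symmetric A A-sym A-diag) (cong (2 *_) (sym (begin
      length (edges G)
        ≡⟨ length-filter-cartesianProduct edge? id (allFin n) ⟩
      ∑[ i < n ] length (filter (λ j → edge? (i , j)) (allFin n))
        ≡⟨ sum-cong-≗ (λ i → length-filter-tabulate (λ j → edge? (i , j)) id) ⟩
      ∑[ i < n ] ∑[ j < n ] χ ((i <ᶠ j) ∧ adjacent? i j)
        ≡⟨ total-cong (λ i j → χ-if (i <ᶠ j) (adjacent? i j)) ⟩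
      ∑[ i < n ] ∑[ j < n ] (if i <ᶠ j then A i j else 0) ∎)))
      where
      open ≡-Reasoning
      edge? = λ ((i , j) : Fin n × Fin n) → (i Fin.<? j) ×-dec adj? G i j
      χ-if : ∀ a b → χ (a ∧ b) ≡ (if a then χ b else 0)
      χ-if true  b = refl
      χ-if false b = refl

    T-AAA : T A A A ≡ 6 * length (triangles G)
    T-AAA = trans (∑-symmetric₃ (λ i j k → A i j * A j k * A i k) swap₁₂ swap₂₃ diag)
      (cong (6 *_) (sym (begin
      length (triangles G)
        ≡⟨ length-filter-cartesianProduct triangle? id (cartesianProduct (allFin n) (allFin n)) ⟩
      ∑[ i < n ] length (filter (λ jk → triangle? (i , jk)) (cartesianProduct (allFin n) (allFin n)))
        ≡⟨ sum-cong-≗ (λ i → trans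
             (length-filter-cartesianProduct (λ jk → triangle? (i , jk)) id (allFin n))
             (sum-cong-≗ λ j → length-filter-tabulate (λ k → triangle? (i , j , k)) id)) ⟩
      ∑[ i < n ] ∑[ j < n ] ∑[ k < n ]
        χ ((i <ᶠ j) ∧ (j <ᶠ k) ∧ adjacent? i j ∧ adjacent? j k ∧ adjacent? i k)
        ≡⟨ total-cong (λ i j → sum-cong-≗ λ k →
             χ-if (i <ᶠ j) (j <ᶠ k) (adjacent? i j) (adjacent? j k) (adjacent? i k)) ⟩
      ∑[ i < n ] ∑[ j < n ] ∑[ k < n ]
        (if j <ᶠ k then (if i <ᶠ j then A i j * A j k * A i k else 0) else 0) ∎)))
      where
      open ≡-Reasoning
      open +-*-Solver
      triangle? = λ ((i , j , k) : Fin n × Fin n × Fin n) →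
        (i Fin.<? j) ×-dec (j Fin.<? k) ×-dec adj? G i j ×-dec adj? G j k ×-dec adj? G i k

      -- The list tests i < j first, while `∑-symmetric₃` tests j < k first; this exchanges the two.
      χ-if : ∀ a b x y z → χ (a ∧ b ∧ x ∧ y ∧ z) ≡
                           (if b then (if a then χ x * χ y * χ z else 0) else 0)
      χ-if true  true  x y z = trans (χ-∧ x (y ∧ z))
        (trans (cong (χ x *_) (χ-∧ y z)) (sym (*-assoc (χ x) (χ y) (χ z))))
      χ-if true  false x y z = refl
      χ-if false true  x y z = refl
      χ-if false false x y z = refl

      swap₁₂ : ∀ i j k → A i j * A j k * A i k ≡ A j i * A i k * A j k
      swap₁₂ i j k = trans (cong (λ a → a * A j k * A i k) (A-sym i j))
        (solve 3 (λ x y z → x :* y :* z := x :* z :* y) refl (A j i) (A j k) (A i k))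

      swap₂₃ : ∀ i j k → A i j * A j k * A i k ≡ A i k * A k j * A i j
      swap₂₃ i j k = trans (cong (λ a → A i j * a * A i k) (A-sym j k))
        (solve 3 (λ x y z → x :* y :* z := z :* y :* x) refl (A i j) (A k j) (A i k))

      diag : ∀ i k → A i i * A i k * A i k ≡ 0
      diag i k = cong (λ a → a * A i k * A i k) (A-diag i)

    -- Vertex triples sorted by the edges they span.

    T-split : ∀ X Y → T X Y 𝟙 ≡ T X Y A + T X Y B + T X Y δ
    -- The pair ik, left free by `𝟙`, is adjacent, distinct and nonadjacent, or equal.
    T-split X Y = trans (T-congʳ X Y (λ i j → sym (A+B+δ≡𝟙 i j)))
      (trans (T-+ʳ X Y (λ i j → A i j + B i j) δ) (cong (_+ T X Y δ) (T-+ʳ X Y A B)))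

    -- S, Q, Q′ and S′ are 6, 2, 2 and 6 times the numbers of vertex triples
    -- spanning 3, 2, 1 and 0 edges.
    E F S Q Q′ S′ : ℕ
    E  = total A
    F  = total B
    S  = T A A A
    Q  = T A A B
    Q′ = T A B B
    S′ = T B B B

    E+F+n≡n*n : E + F + n ≡ n * n
    E+F+n≡n*n = sym (begin
      n * n
        ≡⟨ trans (sum-cong-≗ {n} (λ _ → trans (∑-const n 1) (*-identityʳ n))) (∑-const n n) ⟨
      total {n} 𝟙
        ≡⟨ total-cong A+B+δ≡𝟙 ⟨
      total {n} (λ i j → A i j + B i j + δ i j)
        ≡⟨ trans (total-+ (λ i j → A i j + B i j) δ) (cong (_+ total {n} δ) (total-+ A B)) ⟩
      E + F + total {n} δ
        ≡⟨ cong (E + F +_) total-δ ⟩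
      E + F + n ∎)
      where
      open ≡-Reasoning
      total-δ : total {n} δ ≡ n
      total-δ = begin
        total {n} δ
          ≡⟨ total-cong {n} (λ i j → *-identityˡ (δ i j)) ⟨
        total {n} (λ i j → 1 * δ i j)
          ≡⟨ sum-cong-≗ {n} (∑-δ (λ _ → 1)) ⟩
        ∑[ i < n ] 1
          ≡⟨ trans (∑-const n 1) (*-identityʳ n) ⟩
        n ∎

    total-zero : ∀ {X} → (∀ i j → X i j ≡ 0) → total {n} X ≡ 0
    total-zero X≡0 = ∑-zero λ i → ∑-zero (X≡0 i)

    -- A walk i, j, k has adjacent ends, distinct nonadjacent ends, or equal ends; in the last case
    -- it runs along an edge and back, which gives `E`.
    T-AA𝟙 : T A A 𝟙 ≡ S + Q + E
    T-AA𝟙 = trans (T-split A A)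
      (cong (S + Q +_) (trans (T-δ A A-sym) (total-cong AA≡A)))

    T-AB𝟙 : T A B 𝟙 ≡ Q + Q′
    T-AB𝟙 = trans (T-split A B) (trans
      (cong₂ (λ x y → x + Q′ + y) (T-swap₂₃ B A A-sym)
        (trans (T-δ A B-sym) (total-zero AB≡0)))
      (+-identityʳ (Q + Q′)))

    T-BB𝟙 : T B B 𝟙 ≡ Q′ + S′ + F
    T-BB𝟙 = trans (T-split B B) (cong₂ (λ x y → x + S′ + y) (T-swap₁₃ B A B-sym)
      (trans (T-δ B B-sym) (total-cong BB≡B)))

    T-BA𝟙 : T B A 𝟙 ≡ T A B 𝟙
    T-BA𝟙 = trans (T-swap₁₃ B 𝟙 A-sym)
      (trans (T-swap₂₃ {X = 𝟙} A B (λ _ _ → refl)) (T-swap₁₃ 𝟙 A B-sym))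

    T-X𝟙𝟙 : ∀ {X} → Sym X → T X 𝟙 𝟙 ≡ T X A 𝟙 + T X B 𝟙 + total X
    T-X𝟙𝟙 {X} symX = trans (T-split X 𝟙)
      (cong₂ _+_ (cong₂ _+_ (T-swap₂₃ 𝟙 A symX) (T-swap₂₃ 𝟙 B symX))
        (trans (T-δ X (λ _ _ → refl)) (total-cong λ i j → *-identityʳ (X i j))))

    -- Counts ordered edges with an arbitrary third vertex. `Q` appears twice because either end of
    -- the edge may be the middle vertex; the two terms `E` come from the third vertex coinciding
    -- with one end or the other.
    nE≡ : n * E ≡ S + Q + E + (Q + Q′) + E
    nE≡ = trans (sym (T-𝟙𝟙 A)) (trans (T-X𝟙𝟙 A-sym)
      (cong₂ (λ x y → x + y + E) T-AA𝟙 T-AB𝟙))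

    -- The same count over nonadjacent pairs. `Q′` appears twice because the single edge may leave
    -- from either end.
    nF≡ : n * F ≡ Q + Q′ + (Q′ + S′ + F) + F
    nF≡ = trans (sym (T-𝟙𝟙 B)) (trans (T-X𝟙𝟙 B-sym)
      (cong₂ (λ x y → x + y + F) (trans T-BA𝟙 T-AB𝟙) T-BB𝟙))

    degree : Fin n → ℕ
    degree i = ∑[ j < n ] A i j

    ∑degree² : ∑[ i < n ] (degree i * degree i) ≡ S + Q + E
    ∑degree² = trans (sym (trans (∑-comm (λ i j → ∑[ k < n ] (A i j * A j k * 1)))
      (sum-cong-≗ λ j → begin
        ∑[ i < n ] ∑[ k < n ] (A i j * A j k * 1)
          ≡⟨ total-cong (λ i k → trans (*-identityʳ (A i j * A j k)) (cong (_* A j k) (A-sym i j))) ⟩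
        ∑[ i < n ] ∑[ k < n ] (A j i * A j k)
          ≡⟨ sum-cong-≗ (λ i → *-distribˡ-sum (A j i) (A j)) ⟨
        ∑[ i < n ] (A j i * degree j)
          ≡⟨ *-distribʳ-sum (degree j) (A j) ⟨
        degree j * degree j ∎))) T-AA𝟙
      where open ≡-Reasoning

    -- Induced four-cycles and common neighbours.

    C₄-copy : ∀ {i j x y} → ¬ Adj G i j → i ≢ j → ¬ Adj G x y → x ≢ y →
      Adj G i x → Adj G j x → Adj G i y → Adj G j y → InducedSubgraph C₄ G
    -- The cycle runs through i, x, j, y in this order; the nonadjacent pairs ij and xy are its
    -- diagonals, so the copy is induced.
    C₄-copy {i} {j} {x} {y} ¬ij i≢j ¬xy x≢y ix jx iy jy = f , injective , preserves
      where
      f : Fin 4 → Fin n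
      f 0F = i
      f 1F = x
      f 2F = j
      f 3F = y

      xi = Graph.sym G ix
      xj = Graph.sym G jx
      yi = Graph.sym G iy
      yj = Graph.sym G jy

      injective : Injective _≡_ _≡_ f
      injective {0F} {0F} _ = refl
      injective {0F} {1F} e = contradiction e (Adj⇒≢ ix)
      injective {0F} {2F} e = contradiction e i≢j
      injective {0F} {3F} e = contradiction e (Adj⇒≢ iy)
      injective {1F} {0F} e = contradiction e (Adj⇒≢ xi)
      injective {1F} {1F} _ = refl
      injective {1F} {2F} e = contradiction e (Adj⇒≢ xj)
      injective {1F} {3F} e = contradiction e x≢y
      injective {2F} {0F} e = contradiction (sym e) i≢j
      injective {2F} {1F} e = contradiction e (Adj⇒≢ jx)
      injective {2F} {2F} _ = refl
      injective {2F} {3F} e = contradiction e (Adj⇒≢ jy)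
      injective {3F} {0F} e = contradiction e (Adj⇒≢ yi)
      injective {3F} {1F} e = contradiction (sym e) x≢y
      injective {3F} {2F} e = contradiction e (Adj⇒≢ yj)
      injective {3F} {3F} _ = refl

      adjacent : ∀ {P Q : Set} → P → Q → P ⇔ Q
      adjacent p q = mk⇔ (λ _ → q) (λ _ → p)

      nonadjacent : ∀ {P Q : Set} → ¬ P → ¬ Q → P ⇔ Q
      nonadjacent ¬p ¬q = mk⇔ (⊥-elim ∘ ¬p) (⊥-elim ∘ ¬q)

      loop : ∀ i → Adj C₄ i i ⇔ Adj G (f i) (f i)
      loop i = nonadjacent (Graph.irrefl C₄ i) (Graph.irrefl G (f i))

      preserves : ∀ i j → Adj C₄ i j ⇔ Adj G (f i) (f j)
      preserves 0F 0F = loop 0F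
      preserves 0F 1F = adjacent (inj₁ refl) ix
      preserves 0F 2F = nonadjacent (λ { (inj₁ ()) ; (inj₂ ()) }) ¬ij
      preserves 0F 3F = adjacent (inj₂ refl) iy
      preserves 1F 0F = adjacent (inj₂ refl) xi
      preserves 1F 1F = loop 1F
      preserves 1F 2F = adjacent (inj₁ refl) xj
      preserves 1F 3F = nonadjacent (λ { (inj₁ ()) ; (inj₂ ()) }) ¬xy
      preserves 2F 0F = nonadjacent (λ { (inj₁ ()) ; (inj₂ ()) }) (¬ij ∘ Graph.sym G)
      preserves 2F 1F = adjacent (inj₂ refl) jx
      preserves 2F 2F = loop 2F
      preserves 2F 3F = adjacent (inj₁ refl) jy
      preserves 3F 0F = adjacent (inj₁ refl) yi
      preserves 3F 1F = nonadjacent (λ { (inj₁ ()) ; (inj₂ ()) }) (¬xy ∘ Graph.sym G)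
      preserves 3F 2F = adjacent (inj₂ refl) yj
      preserves 3F 3F = loop 3F

    -- The condition on `j` comes first to match the factors `A j k * A i k` of `T`.
    commonNeighbours : Fin n → Fin n → Subset n
    commonNeighbours i j = Vec.tabulate λ k → does (adj? G j k ×-dec adj? G i k)

    ∈-commonNeighbours⁻ : ∀ {i j k} → k ∈ commonNeighbours i j → Adj G j k × Adj G i k
    ∈-commonNeighbours⁻ {i} {j} {k} k∈ = does-true⇒ (adj? G j k ×-dec adj? G i k)
      (trans (sym (lookup∘tabulate _ k)) ([]=⇒lookup k∈))

    ∣commonNeighbours∣ : ∀ i j → ∣ commonNeighbours i j ∣ ≡ ∑[ k < n ] (A j k * A i k)
    ∣commonNeighbours∣ i j = trans (∣tabulate∣ λ k → does (adj? G j k ×-dec adj? G i k))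
      (sum-cong-≗ λ k → χ-∧ (adjacent? j k) (adjacent? i k))

    -- The two counting inequalities for graphs without induced four-cycles.

    module _ (C₄-free : C₄-Free G) where

      -- Two nonadjacent common neighbours would close an induced four-cycle with i and j.
      -- Decidability of adjacency turns this refutation into an edge.
      commonNeighbours-clique : ∀ {i j} → ¬ Adj G i j → i ≢ j → IsClique G (commonNeighbours i j)
      commonNeighbours-clique ¬ij i≢j x y x∈ y∈ x≢y
        with jx , ix ← ∈-commonNeighbours⁻ x∈ | jy , iy ← ∈-commonNeighbours⁻ y∈ =
        decidable-stable (adj? G x y) λ ¬xy →
          C₄-free (C₄-copy ¬ij i≢j ¬xy x≢y ix jx iy jy)

      Q≤F*ω : Q ≤ F * cliqueNumber G
      Q≤F*ω = begin
        T A A B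
          -- The nonadjacent pair moves to ij, so that k becomes the middle vertex and, for fixed i
          -- and j, runs over their common neighbours.
          ≡⟨ T-swap₁₃ A B A-sym ⟩
        ∑[ i < n ] ∑[ j < n ] ∑[ k < n ] (B i j * A j k * A i k)
          ≡⟨ total-cong (λ i j → trans (sum-cong-≗ λ k → *-assoc (B i j) (A j k) (A i k))
               (sym (*-distribˡ-sum (B i j) (λ k → A j k * A i k)))) ⟩
        ∑[ i < n ] ∑[ j < n ] (B i j * ∑[ k < n ] (A j k * A i k))
          ≤⟨ ∑-mono (λ i → ∑-mono λ j → nonadjacent≤ i j) ⟩
        ∑[ i < n ] ∑[ j < n ] (B i j * cliqueNumber G)
          ≡⟨ total-*ʳ B (cliqueNumber G) ⟨
        F * cliqueNumber G ∎
        where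
        open ≤-Reasoning
        nonadjacent≤ : ∀ i j → B i j * ∑[ k < n ] (A j k * A i k) ≤ B i j * cliqueNumber G
        nonadjacent≤ i j with adj? G i j | i Fin.≟ j
        ... | yes _  | _       = z≤n
        ... | no _   | yes _   = z≤n
        ... | no ¬ij | no i≢j = *-monoʳ-≤ 1 (subst (_≤ cliqueNumber G) (∣commonNeighbours∣ i j)
          (clique⇒∣S∣≤cliqueNumber (commonNeighbours-clique ¬ij i≢j)))

      cherry-bound : E * E ≤ n * (S + F * cliqueNumber G + E)
      cherry-bound = begin
        E * E
          -- `E` is by definition the sum of the degrees.
          ≤⟨ cauchy-schwarz degree ⟩
        n * ∑[ i < n ] (degree i * degree i)
          ≡⟨ cong (n *_) ∑degree² ⟩
        n * (S + Q + E)
          ≤⟨ *-monoʳ-≤ n (+-monoˡ-≤ E (+-monoʳ-≤ S Q≤F*ω)) ⟩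
        n * (S + F * cliqueNumber G + E) ∎
        where open ≤-Reasoning

      -- `Q′` occurs once in `n * E` and twice in `n * F`, so twice the first minus the second
      -- eliminates it, leaving 2S + 3Q + 4E - S′ - 2F. The negative terms are moved across to stay
      -- in ℕ, and `S′` is dropped.
      triple-bound : 2 * (n * E) + 2 * F ≤ 2 * S + 3 * (F * cliqueNumber G) + 4 * E + n * F
      triple-bound = begin
        2 * (n * E) + 2 * F
          ≡⟨ cong (λ x → 2 * x + 2 * F) nE≡ ⟩
        2 * (S + Q + E + (Q + Q′) + E) + 2 * F
          ≤⟨ m≤m+n _ S′ ⟩
        2 * (S + Q + E + (Q + Q′) + E) + 2 * F + S′
          ≡⟨ solve 6 (λ s q e q′ f s′ →
               con 2 :* (s :+ q :+ e :+ (q :+ q′) :+ e) :+ con 2 :* f :+ s′ :=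
               con 2 :* s :+ con 3 :* q :+ con 4 :* e :+ (q :+ q′ :+ (q′ :+ s′ :+ f) :+ f))
               refl S Q E Q′ F S′ ⟩
        2 * S + 3 * Q + 4 * E + (Q + Q′ + (Q′ + S′ + F) + F)
          ≡⟨ cong (2 * S + 3 * Q + 4 * E +_) nF≡ ⟨
        2 * S + 3 * Q + 4 * E + n * F
          ≤⟨ +-monoˡ-≤ (n * F) (+-monoˡ-≤ (4 * E) (+-monoʳ-≤ (2 * S) (*-monoʳ-≤ 3 Q≤F*ω))) ⟩
        2 * S + 3 * (F * cliqueNumber G) + 4 * E + n * F ∎
        where
        open ≤-Reasoning
        open +-*-Solver

-- Counts as rationals, and binomial coefficients as falling factorials.

module RationalArithmetic where
  open import Data.Integer.Base as ℤ using (+_)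
  import Data.Integer.Properties as ℤ
  import Data.Nat.Base as ℕ
  open import Data.Nat.Combinatorics using (_C_; nCk+nC[k+1]≡[n+1]C[k+1]; nC1≡n)
  import Data.Nat.Properties as ℕ
  import Data.Nat.Solver as ℕ
  open import Data.Rational.Base hiding (NonZero)
  open import Data.Rational.Properties
  open import Data.Rational.Solver using (module +-*-Solver)
  import Data.Rational.Unnormalised.Base as ℚᵘ
  import Data.Rational.Unnormalised.Properties as ℚᵘ

  -- Unnormalised fractions add without reduction to lowest terms, so the arithmetic of `fromℕ` is
  -- checked there; `fromℕ` is `fromℚᵘ` of a fraction with denominator 1.
  fromℚᵘ-homo-+ : ∀ p q → fromℚᵘ p + fromℚᵘ q ≡ fromℚᵘ (p ℚᵘ.+ q)
  fromℚᵘ-homo-+ p q = toℚᵘ-injective (begin-equality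
    toℚᵘ (fromℚᵘ p + fromℚᵘ q)              ≃⟨ toℚᵘ-homo-+ (fromℚᵘ p) (fromℚᵘ q) ⟩
    toℚᵘ (fromℚᵘ p) ℚᵘ.+ toℚᵘ (fromℚᵘ q)    ≃⟨ ℚᵘ.+-cong (toℚᵘ-fromℚᵘ p) (toℚᵘ-fromℚᵘ q) ⟩
    p ℚᵘ.+ q                                ≃⟨ toℚᵘ-fromℚᵘ (p ℚᵘ.+ q) ⟨
    toℚᵘ (fromℚᵘ (p ℚᵘ.+ q))                ∎)
    where open ℚᵘ.≤-Reasoning

  fromℚᵘ-homo-* : ∀ p q → fromℚᵘ p * fromℚᵘ q ≡ fromℚᵘ (p ℚᵘ.* q)
  fromℚᵘ-homo-* p q = toℚᵘ-injective (begin-equality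
    toℚᵘ (fromℚᵘ p * fromℚᵘ q)              ≃⟨ toℚᵘ-homo-* (fromℚᵘ p) (fromℚᵘ q) ⟩
    toℚᵘ (fromℚᵘ p) ℚᵘ.* toℚᵘ (fromℚᵘ q)    ≃⟨ ℚᵘ.*-cong (toℚᵘ-fromℚᵘ p) (toℚᵘ-fromℚᵘ q) ⟩
    p ℚᵘ.* q                                ≃⟨ toℚᵘ-fromℚᵘ (p ℚᵘ.* q) ⟨
    toℚᵘ (fromℚᵘ (p ℚᵘ.* q))                ∎)
    where open ℚᵘ.≤-Reasoning

  fromℕ-+ : ∀ m n → fromℕ (m ℕ.+ n) ≡ fromℕ m + fromℕ n
  fromℕ-+ m n = sym (trans (fromℚᵘ-homo-+ (ℚᵘ.mkℚᵘ (+ m) 0) (ℚᵘ.mkℚᵘ (+ n) 0))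
    (cong (_/ 1) (cong₂ ℤ._+_ (ℤ.*-identityʳ (+ m)) (ℤ.*-identityʳ (+ n)))))

  fromℕ-* : ∀ m n → fromℕ (m ℕ.* n) ≡ fromℕ m * fromℕ n
  fromℕ-* m n = sym (trans (fromℚᵘ-homo-* (ℚᵘ.mkℚᵘ (+ m) 0) (ℚᵘ.mkℚᵘ (+ n) 0))
    (cong (_/ 1) (sym (ℤ.pos-* m n))))

  fromℕ-mono-≤ : ∀ {m n} → m ℕ.≤ n → fromℕ m ≤ fromℕ n
  fromℕ-mono-≤ {m} {n} m≤n = toℚᵘ-cancel-≤ (begin
    toℚᵘ (fromℕ m)      ≃⟨ toℚᵘ-fromℚᵘ (ℚᵘ.mkℚᵘ (+ m) 0) ⟩
    ℚᵘ.mkℚᵘ (+ m) 0     ≤⟨ ℚᵘ.*≤* (ℤ.*-monoʳ-≤-nonNeg (+ 1) (ℤ.+≤+ m≤n)) ⟩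
    ℚᵘ.mkℚᵘ (+ n) 0     ≃⟨ toℚᵘ-fromℚᵘ (ℚᵘ.mkℚᵘ (+ n) 0) ⟨
    toℚᵘ (fromℕ n)      ∎)
    where open ℚᵘ.≤-Reasoning

  /-*-fromℕ : ∀ a d .{{_ : ℕ.NonZero d}} → (+ a / d) * fromℕ d ≡ fromℕ a
  /-*-fromℕ a (suc d) = trans (fromℚᵘ-homo-* (ℚᵘ.mkℚᵘ (+ a) d) (ℚᵘ.mkℚᵘ (+ suc d) 0))
    (fromℚᵘ-cong {ℚᵘ.mkℚᵘ (+ a) d ℚᵘ.* ℚᵘ.mkℚᵘ (+ suc d) 0} {ℚᵘ.mkℚᵘ (+ a) 0}
      (ℚᵘ.*≡* (ℤ.*-assoc (+ a) (+ suc d) (+ 1))))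

  -- Turns a density into a count of ordered tuples: `d` is a binomial coefficient, `c` is 2 or 6,
  -- and `e` is the falling factorial.
  /-*-fromℕ-multiple : ∀ a d .{{_ : ℕ.NonZero d}} c {e} → d ℕ.* c ≡ e →
    (+ a / d) * fromℕ e ≡ fromℕ (c ℕ.* a)
  /-*-fromℕ-multiple a d c refl = begin
    (+ a / d) * fromℕ (d ℕ.* c)
      ≡⟨ cong ((+ a / d) *_) (fromℕ-* d c) ⟩
    (+ a / d) * (fromℕ d * fromℕ c)
      ≡⟨ *-assoc (+ a / d) (fromℕ d) (fromℕ c) ⟨
    (+ a / d) * fromℕ d * fromℕ c
      ≡⟨ cong (_* fromℕ c) (/-*-fromℕ a d) ⟩
    fromℕ a * fromℕ c
      ≡⟨ fromℕ-* a c ⟨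
    fromℕ (a ℕ.* c)
      ≡⟨ cong fromℕ (ℕ.*-comm a c) ⟩
    fromℕ (c ℕ.* a) ∎
    where open ≡-Reasoning

  -- Induction by Pascal's rule. The index is shifted so that the falling factorial contains no
  -- truncated subtraction; the same holds for `[2+n]C3*6`.
  [1+n]C2*2 : ∀ n → (suc n C 2) ℕ.* 2 ≡ suc n ℕ.* n
  [1+n]C2*2 zero    = refl
  [1+n]C2*2 (suc n) = begin
    (suc (suc n) C 2) ℕ.* 2
      ≡⟨ cong (ℕ._* 2) (nCk+nC[k+1]≡[n+1]C[k+1] (suc n) 1) ⟨
    ((suc n C 1) ℕ.+ (suc n C 2)) ℕ.* 2
      ≡⟨ trans (ℕ.*-distribʳ-+ 2 (suc n C 1) _)
           (cong₂ ℕ._+_ (cong (ℕ._* 2) (nC1≡n (suc n))) ([1+n]C2*2 n)) ⟩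
    suc n ℕ.* 2 ℕ.+ suc n ℕ.* n
      ≡⟨ solve 1 (λ n → (con 1 :+ n) :* con 2 :+ (con 1 :+ n) :* n :=
                        (con 2 :+ n) :* (con 1 :+ n)) refl n ⟩
    suc (suc n) ℕ.* suc n ∎
    where
    open ≡-Reasoning
    open ℕ.+-*-Solver

  [2+n]C3*6 : ∀ n → (suc (suc n) C 3) ℕ.* 6 ≡ suc (suc n) ℕ.* suc n ℕ.* n
  [2+n]C3*6 zero    = refl
  [2+n]C3*6 (suc n) = begin
    (suc (suc (suc n)) C 3) ℕ.* 6
      ≡⟨ cong (ℕ._* 6) (nCk+nC[k+1]≡[n+1]C[k+1] (suc (suc n)) 2) ⟨
    ((suc (suc n) C 2) ℕ.+ (suc (suc n) C 3)) ℕ.* 6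
      ≡⟨ trans (ℕ.*-distribʳ-+ 6 (suc (suc n) C 2) _)
           (cong₂ ℕ._+_ (trans (sym (ℕ.*-assoc (suc (suc n) C 2) 2 3))
             (cong (ℕ._* 3) ([1+n]C2*2 (suc n)))) ([2+n]C3*6 n)) ⟩
    suc (suc n) ℕ.* suc n ℕ.* 3 ℕ.+ suc (suc n) ℕ.* suc n ℕ.* n
      ≡⟨ solve 1 (λ n → (con 2 :+ n) :* (con 1 :+ n) :* con 3 :+ (con 2 :+ n) :* (con 1 :+ n) :* n :=
                        (con 3 :+ n) :* (con 2 :+ n) :* (con 1 :+ n)) refl n ⟩
    suc (suc (suc n)) ℕ.* suc (suc n) ℕ.* suc n ∎
    where
    open ≡-Reasoning
    open ℕ.+-*-Solver

  p≤q+r⇒p-r≤q : ∀ {p q} r → p ≤ q + r → p - r ≤ q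
  p≤q+r⇒p-r≤q {p} {q} r p≤q+r = begin
    p - r        ≤⟨ +-monoˡ-≤ (- r) p≤q+r ⟩
    q + r - r    ≡⟨ solve 2 (λ q r → q :+ r :- r := q) refl q r ⟩
    q            ∎
    where
    open ≤-Reasoning
    open +-*-Solver

  -- The density inequalities with denominators cleared.

  module _ {M : ℚ} .{{_ : Positive M}} {i : ℚ} (i*M≡1 : i * M ≡ 1ℚ) where
    open +-*-Solver

    private
      -- With `M` standing for n - 2, `N` is n and `K` is n(n - 1), the number of ordered pairs of
      -- distinct vertices; `i` is the inverse of `M`.
      N K : ℚ
      N = fromℕ 2 + M
      K = N * (1ℚ + M)

      instance
        N-pos : Positive N
        N-pos = pos+pos⇒pos (fromℕ 2) M
        K-pos : Positive K
        K-pos = pos*pos⇒pos N (1ℚ + M) {{pos+pos⇒pos 1ℚ M}}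

    -- Cancelling `K` and `N` in the hypothesis leaves `ε * ε * (1ℚ + M)` at most τM + (1 - ε)ω + ε;
    -- the goal is this inequality rearranged and divided by `M`.
    τ-bound₁ : ∀ {ε τ ω} →
      (ε * K) * (ε * K) ≤ N * (τ * (K * M) + (1ℚ - ε) * K * ω + ε * K) →
      ε * ε - ((1ℚ - ε) * (ω + ε)) * i ≤ τ
    τ-bound₁ {ε} {τ} {ω} hyp = *-cancelʳ-≤-pos M (begin
      (ε * ε - ((1ℚ - ε) * (ω + ε)) * i) * M
        ≡⟨ solve 4 (λ ε ω i M → (ε :* ε :- ((con 1ℚ :- ε) :* (ω :+ ε)) :* i) :* M :=
                                ε :* ε :* M :- (con 1ℚ :- ε) :* (ω :+ ε) :* (i :* M))
             refl ε ω i M ⟩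
      ε * ε * M - (1ℚ - ε) * (ω + ε) * (i * M)
        ≡⟨ cong (λ x → ε * ε * M - (1ℚ - ε) * (ω + ε) * x) i*M≡1 ⟩
      ε * ε * M - (1ℚ - ε) * (ω + ε) * 1ℚ
        -- Since (1 - ε)ε = ε - ε², a further `ε * ε` joins the first term and turns its factor `M`
        -- into `1ℚ + M`.
        ≡⟨ solve 3 (λ ε ω M → ε :* ε :* M :- (con 1ℚ :- ε) :* (ω :+ ε) :* con 1ℚ :=
                              ε :* ε :* (con 1ℚ :+ M) :- ((con 1ℚ :- ε) :* ω :+ ε))
             refl ε ω M ⟩
      ε * ε * (1ℚ + M) - ((1ℚ - ε) * ω + ε)
        ≤⟨ p≤q+r⇒p-r≤q {ε * ε * (1ℚ + M)} {τ * M} ((1ℚ - ε) * ω + ε)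
           (*-cancelʳ-≤-pos K (*-cancelʳ-≤-pos N scaled)) ⟩
      τ * M ∎)
      where
      open ≤-Reasoning
      scaled : ε * ε * (1ℚ + M) * K * N ≤ (τ * M + ((1ℚ - ε) * ω + ε)) * K * N
      scaled = subst₂ _≤_
        (solve 3 (λ ε M N → (ε :* (N :* (con 1ℚ :+ M))) :* (ε :* (N :* (con 1ℚ :+ M))) :=
                            ε :* ε :* (con 1ℚ :+ M) :* (N :* (con 1ℚ :+ M)) :* N)
          refl ε M N)
        (solve 6 (λ ε τ ω M N K →
            N :* (τ :* (K :* M) :+ (con 1ℚ :- ε) :* K :* ω :+ ε :* K) :=
            (τ :* M :+ ((con 1ℚ :- ε) :* ω :+ ε)) :* K :* N)
          refl ε τ ω M N K)
        hyp

    -- The goal is multiplied by `M * fromℕ 2` to clear both `i` and the coefficient 3/2, and `K` is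
    -- cancelled from the hypothesis.
    τ-bound₂ : ∀ {ε τ ω} →
      fromℕ 2 * (N * (ε * K)) + fromℕ 2 * ((1ℚ - ε) * K) ≤
      fromℕ 2 * (τ * (K * M)) + fromℕ 3 * ((1ℚ - ε) * K * ω) + fromℕ 4 * (ε * K) +
        N * ((1ℚ - ε) * K) →
      1ℚ - (+ 3 / 2) * (1ℚ - ε) * (1ℚ + ω * i) ≤ τ
    τ-bound₂ {ε} {τ} {ω} hyp = *-cancelʳ-≤-pos (M * fromℕ 2) {{pos*pos⇒pos M (fromℕ 2)}} (begin
      (1ℚ - (+ 3 / 2) * (1ℚ - ε) * (1ℚ + ω * i)) * (M * fromℕ 2)
        ≡⟨ solve 4 (λ ε ω i M →
             (con 1ℚ :- con (+ 3 / 2) :* (con 1ℚ :- ε) :* (con 1ℚ :+ ω :* i)) :* (M :* con (fromℕ 2)) :=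
             con (fromℕ 2) :* M :- con (fromℕ 3) :* (con 1ℚ :- ε) :* (M :+ ω :* (i :* M)))
             refl ε ω i M ⟩
      fromℕ 2 * M - fromℕ 3 * (1ℚ - ε) * (M + ω * (i * M))
        ≡⟨ cong (λ x → fromℕ 2 * M - fromℕ 3 * (1ℚ - ε) * (M + ω * x)) i*M≡1 ⟩
      fromℕ 2 * M - fromℕ 3 * (1ℚ - ε) * (M + ω * 1ℚ)
        -- Because `N` is 2 + M, the combination 2Nε + 2(1 - ε) - 4ε - N(1 - ε) equals 2M - 3(1 -
        -- ε)M.
        ≡⟨ solve 3 (λ ε ω M →
             con (fromℕ 2) :* M :- con (fromℕ 3) :* (con 1ℚ :- ε) :* (M :+ ω :* con 1ℚ) :=
             con (fromℕ 2) :* ((con (fromℕ 2) :+ M) :* ε) :+ con (fromℕ 2) :* (con 1ℚ :- ε) :-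
               (con (fromℕ 3) :* ((con 1ℚ :- ε) :* ω) :+ con (fromℕ 4) :* ε :+
                (con (fromℕ 2) :+ M) :* (con 1ℚ :- ε)))
             refl ε ω M ⟩
      fromℕ 2 * (N * ε) + fromℕ 2 * (1ℚ - ε) - r
        ≤⟨ p≤q+r⇒p-r≤q {fromℕ 2 * (N * ε) + fromℕ 2 * (1ℚ - ε)} {τ * (M * fromℕ 2)} r
           (*-cancelʳ-≤-pos K scaled) ⟩
      τ * (M * fromℕ 2) ∎)
      where
      open ≤-Reasoning
      r : ℚ
      r = fromℕ 3 * ((1ℚ - ε) * ω) + fromℕ 4 * ε + N * (1ℚ - ε)

      scaled : (fromℕ 2 * (N * ε) + fromℕ 2 * (1ℚ - ε)) * K ≤ (τ * (M * fromℕ 2) + r) * K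
      scaled = subst₂ _≤_
        (solve 3 (λ ε N K → con (fromℕ 2) :* (N :* (ε :* K)) :+ con (fromℕ 2) :* ((con 1ℚ :- ε) :* K) :=
            (con (fromℕ 2) :* (N :* ε) :+ con (fromℕ 2) :* (con 1ℚ :- ε)) :* K)
          refl ε N K)
        (solve 6 (λ ε τ ω M N K →
            con (fromℕ 2) :* (τ :* (K :* M)) :+ con (fromℕ 3) :* ((con 1ℚ :- ε) :* K :* ω) :+
              con (fromℕ 4) :* (ε :* K) :+ N :* ((con 1ℚ :- ε) :* K) :=
            (τ :* (M :* con (fromℕ 2)) :+
              (con (fromℕ 3) :* ((con 1ℚ :- ε) :* ω) :+ con (fromℕ 4) :* ε :+ N :* (con 1ℚ :- ε))) :* K)
          refl ε τ ω M N K)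
        hyp

  -- The counts expressed through densities.

  module _ (k : ℕ) .{{_ : ℕ.NonZero k}} (E F S w : ℕ) (ε τ : ℚ)
    (ε*K≡E : ε * fromℕ ((2 ℕ.+ k) ℕ.* (1 ℕ.+ k)) ≡ fromℕ E)
    (τ*KM≡S : τ * fromℕ ((2 ℕ.+ k) ℕ.* (1 ℕ.+ k) ℕ.* k) ≡ fromℕ S)
    (E+F+n≡n*n : E ℕ.+ F ℕ.+ (2 ℕ.+ k) ≡ (2 ℕ.+ k) ℕ.* (2 ℕ.+ k))
    where

    private
      n : ℕ
      n = 2 ℕ.+ k

      M N K ω : ℚ
      M = fromℕ k
      N = fromℕ 2 + M
      K = N * (1ℚ + M)
      ω = fromℕ w

      instance
        M-pos : Positive M
        M-pos = normalize-pos k 1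

      n≡ : fromℕ n ≡ N
      n≡ = fromℕ-+ 2 k

      K≡ : fromℕ (n ℕ.* suc k) ≡ K
      K≡ = trans (fromℕ-* n (suc k)) (cong₂ _*_ n≡ (fromℕ-+ 1 k))

      E≡ : fromℕ E ≡ ε * K
      E≡ = trans (sym ε*K≡E) (cong (ε *_) K≡)

      S≡ : fromℕ S ≡ τ * (K * M)
      S≡ = trans (sym τ*KM≡S) (cong (τ *_) (trans (fromℕ-* (n ℕ.* suc k) k) (cong (_* M) K≡)))

      -- `K` equals n² - n, and the adjacent ordered pairs make up the share ε of it. `K` is
      -- unfolded in `M` so that the solver can see this.
      F≡ : fromℕ F ≡ (1ℚ - ε) * K
      F≡ = begin
        fromℕ F
          ≡⟨ solve 3 (λ e f n → f := e :+ f :+ n :- n :- e) refl (fromℕ E) (fromℕ F) (fromℕ n) ⟩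
        fromℕ E + fromℕ F + fromℕ n - fromℕ n - fromℕ E
          ≡⟨ cong (λ x → x - fromℕ n - fromℕ E) (trans
               (sym (trans (fromℕ-+ (E ℕ.+ F) n) (cong (_+ fromℕ n) (fromℕ-+ E F))))
               (trans (cong fromℕ E+F+n≡n*n) (fromℕ-* n n))) ⟩
        fromℕ n * fromℕ n - fromℕ n - fromℕ E
          ≡⟨ cong₂ (λ x y → x * x - x - y) n≡ E≡ ⟩
        N * N - N - ε * K
          ≡⟨ solve 2 (λ M ε →
               (con (fromℕ 2) :+ M) :* (con (fromℕ 2) :+ M) :- (con (fromℕ 2) :+ M) :-
                 ε :* ((con (fromℕ 2) :+ M) :* (con 1ℚ :+ M)) :=
               (con 1ℚ :- ε) :* ((con (fromℕ 2) :+ M) :* (con 1ℚ :+ M))) refl M ε ⟩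
        (1ℚ - ε) * K ∎
        where
        open ≡-Reasoning
        open +-*-Solver

      Fω≡ : fromℕ (F ℕ.* w) ≡ (1ℚ - ε) * K * ω
      Fω≡ = trans (fromℕ-* F w) (cong (_* ω) F≡)

      scaled : ∀ c {x p} → fromℕ x ≡ p → fromℕ (c ℕ.* x) ≡ fromℕ c * p
      scaled c {x} x≡p = trans (fromℕ-* c x) (cong (fromℕ c *_) x≡p)

    density-bound₁ : E ℕ.* E ℕ.≤ n ℕ.* (S ℕ.+ F ℕ.* w ℕ.+ E) →
      ε * ε - ((1ℚ - ε) * (ω + ε)) /ℕ k ≤ τ
    density-bound₁ hyp = τ-bound₁ (/-*-fromℕ 1 k) {ε} {τ} {ω} (subst₂ _≤_
      (trans (fromℕ-* E E) (cong₂ _*_ E≡ E≡))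
      (trans (fromℕ-* n (S ℕ.+ F ℕ.* w ℕ.+ E)) (cong₂ _*_ n≡
        (trans (fromℕ-+ (S ℕ.+ F ℕ.* w) E) (cong₂ _+_
          (trans (fromℕ-+ S (F ℕ.* w)) (cong₂ _+_ S≡ Fω≡)) E≡))))
      (fromℕ-mono-≤ hyp))

    density-bound₂ :
      2 ℕ.* (n ℕ.* E) ℕ.+ 2 ℕ.* F ℕ.≤ 2 ℕ.* S ℕ.+ 3 ℕ.* (F ℕ.* w) ℕ.+ 4 ℕ.* E ℕ.+ n ℕ.* F →
      1ℚ - (+ 3 / 2) * (1ℚ - ε) * (1ℚ + ω /ℕ k) ≤ τ
    density-bound₂ hyp = τ-bound₂ (/-*-fromℕ 1 k) {ε} {τ} {ω} (subst₂ _≤_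
      (trans (fromℕ-+ (2 ℕ.* (n ℕ.* E)) (2 ℕ.* F)) (cong₂ _+_
        (scaled 2 {n ℕ.* E} (trans (fromℕ-* n E) (cong₂ _*_ n≡ E≡))) (scaled 2 {F} F≡)))
      (trans (fromℕ-+ (2 ℕ.* S ℕ.+ 3 ℕ.* (F ℕ.* w) ℕ.+ 4 ℕ.* E) (n ℕ.* F)) (cong₂ _+_
        (trans (fromℕ-+ (2 ℕ.* S ℕ.+ 3 ℕ.* (F ℕ.* w)) (4 ℕ.* E)) (cong₂ _+_
          (trans (fromℕ-+ (2 ℕ.* S) (3 ℕ.* (F ℕ.* w)))
            (cong₂ _+_ (scaled 2 {S} S≡) (scaled 3 {F ℕ.* w} Fω≡)))
          (scaled 4 {E} E≡)))
        (trans (fromℕ-* n F) (cong₂ _*_ n≡ F≡))))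
      (fromℕ-mono-≤ hyp))

-- The two lower bounds on the triangle density.

open Counting using (cherry-bound; triple-bound; total-A; T-AAA; E+F+n≡n*n)
open RationalArithmetic

open import Data.Integer.Base using (+_)
open import Data.List.Base using (length)
open import Data.Nat.Combinatorics using (_C_)
open import Data.Nat.Base as ℕ using (_∸_; _≤_; s≤s)
open import Data.Nat.Properties using (<⇒≤)
import Data.Rational.Base as ℚ
open import Data.Rational.Base using (ℚ; 1ℚ; _+_; _-_; _*_; _/_; _⊔_; _≥_)
open import Data.Rational.Properties using (⊔-lub)

theorem1 : ∀ (n : ℕ) (3≤n : 3 ≤ n) (G : Graph n) → C₄-Free G →
  let instance
        n∸2≢0 = n∸2-nonZero 3≤n
      ε = edgeDensity G (<⇒≤ 3≤n)
      τ = triangleDensity G 3≤n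
      κ = cliqueNumberDensity G (<⇒≤ (<⇒≤ 3≤n))
  in τ ≥ (ε * ε - ((1ℚ - ε) * (κ * fromℕ n + ε)) /ℕ (n ∸ 2))
       ⊔ (1ℚ - (+ 3 / 2) * (1ℚ - ε) * (1ℚ + (κ * fromℕ n) /ℕ (n ∸ 2)))
-- As n is at least 3, it is 2 + k with k positive, and `n ∸ 2` reduces to `k`.
theorem1 n@(suc (suc k@(suc _))) 3≤n@(s≤s (s≤s (s≤s _))) G C₄-free = ⊔-lub
  (subst (λ x → ε * ε - ((1ℚ - ε) * (x + ε)) /ℕ k ℚ.≤ τ) (sym κ*n≡ω)
    (density-bound₁ k E F S ω ε τ ε*K≡E τ*KM≡S (E+F+n≡n*n G) (cherry-bound G C₄-free)))
  (subst (λ x → 1ℚ - (+ 3 / 2) * (1ℚ - ε) * (1ℚ + x /ℕ k) ℚ.≤ τ) (sym κ*n≡ω)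
    (density-bound₂ k E F S ω ε τ ε*K≡E τ*KM≡S (E+F+n≡n*n G) (triple-bound G C₄-free)))
  where
  E = Counting.E G
  F = Counting.F G
  S = Counting.S G
  ω = cliqueNumber G
  ε = edgeDensity G (<⇒≤ 3≤n)
  τ = triangleDensity G 3≤n

  -- Lets the bounds, proved with the clique number itself, be restated through its density.
  κ*n≡ω : cliqueNumberDensity G (<⇒≤ (<⇒≤ 3≤n)) * fromℕ n ≡ fromℕ ω
  κ*n≡ω = /-*-fromℕ ω n

  ε*K≡E : ε * fromℕ (n ℕ.* suc k) ≡ fromℕ E
  ε*K≡E = trans
    (/-*-fromℕ-multiple (length (edges G)) (n C 2) {{nCk-nonZero (<⇒≤ 3≤n)}} 2
      ([1+n]C2*2 (suc k)))
    (cong fromℕ (sym (total-A G)))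

  τ*KM≡S : τ * fromℕ (n ℕ.* suc k ℕ.* k) ≡ fromℕ S
  τ*KM≡S = trans
    (/-*-fromℕ-multiple (length (triangles G)) (n C 3) {{nCk-nonZero 3≤n}} 6 ([2+n]C3*6 k))
    (cong fromℕ (sym (T-AAA G)))
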